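{- Let $m\ge2$. If $\mathcal{B}=\{B_i : 1\leq i\leq m\}$ is an $(n,m;k_1,k_2,\dots,k_m;\lambda_1,\lambda_2,\dots,\lambda_m)$-BGSEDF, then $\mathcal{B}$ is an $(n,m,(k_1,k_2,\dots,k_m),a=\sum_{1\leq i\leq m}k_i,\lambda)$-BSWEDF for some $\lambda$ with $\lambda\leq\sum_{1\leq i\leq m}\frac{\lambda_i\widetilde{k}}{k_i}$, where $\widetilde{k}=\mathrm{lcm}(k_1,\dots,k_m)$.
   Context: Let $G$ be an additive Abelian group of order $n$ with identity $0$. For multi-sets $B_1,B_2$ of elements of $G$, $D(B_1,B_2)$ is the multi-set $\{x-y : x\in B_1,\ y\in B_2\}$; $c\boxtimes B$ is the multi-set in which each element of $B$ is repeated $c$ times; unions are multi-set unions. Let $\mathcal{B}=\{B_i : 1\le i\le m\}$ be a family of pairwise disjoint nonempty subsets of $G$ with $k_i=|B_i|$. $\mathcal{B}$ is an $(n,m;k_1,\dots,k_m;\lambda_1,\dots,\lambda_m)$-bounded generalized strong external difference family (BGSEDF) if for each $1\le i\le m$, $\bigcup_{1\le j\le m,\ j\ne i}D(B_i,B_j)\subseteq\lambda_i\boxtimes(G\setminus\{0\})$. With $K=(k_1,\dots,k_m)$, $a=\sum_i k_i$, $\widetilde{k}=\mathrm{lcm}(k_1,\dots,k_m)$ and $\widetilde{B}_i=\frac{\widetilde{k}}{k_i}\boxtimes B_i$, $\mathcal{B}$ is an $(n,m,K,a,\lambda)$-BSWEDF (bounded standard weighted external difference family) if $\lambda$ is the smallest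 positive integer such that $\bigcup_{1\le i\ne j\le m}D(B_i,\widetilde{B}_j)\subseteq\lambda\boxtimes(G\setminus\{0\})$. -}

module Defs where

open import Algebra.Bundles using (AbelianGroup)
open import Data.Fin.Base using (Fin)
import Data.Fin.Properties as Fin
open import Data.List.Base using (List; []; length; filter; map; concatMap; replicate; allFin; cartesianProductWith)
import Data.List.Membership.Setoid as Membership
import Data.List.Relation.Binary.Disjoint.Setoid as Disjointness
import Data.List.Relation.Unary.Unique.Setoid as Uniqueness
open import Data.Nat.Base using (ℕ; NonZero; ≢-nonZero; _/_; _≤_; _<_)
open import Data.Nat.LCM using (lcm)
open import Data.Nat.Properties using (+-0-monoid)
open import Algebra.Properties.Monoid.Sum +-0-monoid public using (sum)
import Data.Vec.Functional as Vector
open import Function.Bundles using (Inverse)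
open import Function.Properties.Inverse using (Inverse⇒Injection)
open import Level using (_⊔_)
open import Relation.Binary.Definitions using (Decidable)
open import Relation.Binary.PropositionalEquality using (_≡_; _≢_; refl; trans; setoid)
open import Relation.Nullary.Decidable using (¬?; via-injection)

HasOrder : ∀ {c ℓ} → AbelianGroup c ℓ → ℕ → Set (c ⊔ ℓ)
HasOrder G n = Inverse (AbelianGroup.setoid G) (setoid (Fin n))

lcms : ∀ {m} → (Fin m → ℕ) → ℕ
lcms = Vector.foldr lcm 1

module _ {c ℓ} (G : AbelianGroup c ℓ) {n : ℕ} (order : HasOrder G n) where

  open AbelianGroup G using (Carrier; _≈_; _-_) renaming (ε to 0#; setoid to S)
  open Disjointness S using (Disjoint)
  open Uniqueness S using (Unique)

  _≈?_ : Decidable _≈_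
  _≈?_ = via-injection (Inverse⇒Injection order) Fin._≟_

  -- A finite multi-set is a list in which only multiplicities matter:
  -- inclusion is defined by comparing them.

  Multiset : Set c
  Multiset = List Carrier

  multiplicity : Carrier → Multiset → ℕ
  multiplicity g B = length (filter (g ≈?_) B)

  infix 4 _⊆_
  _⊆_ : Multiset → Multiset → Set c
  A ⊆ B = ∀ g → multiplicity g A ≤ multiplicity g B

  infixr 7 _⊠_
  _⊠_ : ℕ → Multiset → Multiset
  t ⊠ B = concatMap (replicate t) B

  D : Multiset → Multiset → Multiset
  D = cartesianProductWith _-_

  G∖0 : Multiset
  G∖0 = filter (λ g → ¬? (g ≈? 0#)) (map (Inverse.from order) (allFin n))

  -- Subsets of G are lists without repetition (up to ≈).
  record DisjointFamily (m : ℕ) (k : Fin m → ℕ) : Set (c ⊔ ℓ) where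
    field
      block    : Fin m → List Carrier
      unique   : ∀ i → Unique (block i)
      nonempty : ∀ i → block i ≢ []
      disjoint : ∀ {i j} → i ≢ j → Disjoint (block i) (block j)
      size     : ∀ i → length (block i) ≡ k i

    k-nonZero : ∀ i → NonZero (k i)
    k-nonZero i = ≢-nonZero λ kᵢ≡0 → nonempty i (length≡0 (trans (size i) kᵢ≡0))
      where
      length≡0 : ∀ {xs : List Carrier} → length xs ≡ 0 → xs ≡ []
      length≡0 {[]} _ = refl

    -- The division is exact, as k i divides lcms k.
    weightedBlock : Fin m → Multiset
    weightedBlock i = (lcms k / k i) {{k-nonZero i}} ⊠ block i

  others : ∀ {m} → Fin m → List (Fin m)
  others {m} i = filter (λ j → ¬? (j Fin.≟ i)) (allFin m)

  module _ {m : ℕ} {k : Fin m → ℕ} (𝓑 : DisjointFamily m k) where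

    open DisjointFamily 𝓑

    externalDifferences : Fin m → Multiset
    externalDifferences i = concatMap (λ j → D (block i) (block j)) (others i)

    weightedExternalDifferences : Multiset
    weightedExternalDifferences =
      concatMap (λ i → concatMap (λ j → D (block i) (weightedBlock j)) (others i)) (allFin m)

    IsBGSEDF : (Fin m → ℕ) → Set c
    IsBGSEDF Λ = ∀ i → externalDifferences i ⊆ Λ i ⊠ G∖0

    record IsBSWEDF (a μ : ℕ) : Set c where
      field
        total    : a ≡ sum k
        positive : 0 < μ
        bounded  : weightedExternalDifferences ⊆ μ ⊠ G∖0
        smallest : ∀ ν → 0 < ν → weightedExternalDifferences ⊆ ν ⊠ G∖0 → μ ≤ ν

{-# OPTIONS --safe #-}

-- Since x - y = g iff y - x = - g, the number of occurrences of g in the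
-- weighted external differences is the sum over j of k̃ / k j times the number
-- of occurrences of - g in the external differences of the j-th block.  The
-- BGSEDF condition bounds the latter by Λ j, or by 0 if g is the identity.
-- As G ∖ {0} has no repetitions, the least admissible μ is the largest
-- multiplicity occurring, or 1 if that is 0.

module Submission where

open import Defs
open import Algebra.Bundles using (AbelianGroup)
import Algebra.Properties.AbelianGroup as AbelianGroupProperties
open import Data.Bool.Base using (if_then_else_; true; false)
open import Data.Fin.Base using (Fin; zero; suc)
import Data.Fin.Properties as Fin
open import Data.List.Base using (List; []; _∷_; _++_; length; map; filter; concatMap; replicate; allFin; tabulate; cartesianProductWith)
open import Data.List.Extrema.Nat using (max; ⊥≤max; xs≤max; max≤v⁺)
open import Data.List.Membership.Propositional.Properties using () renaming (∈-allFin to ∈ₚ-allFin; ∈-filter⁺ to ∈ₚ-filter⁺)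
open import Data.List.Membership.Setoid.Properties using (∈-map⁺; ∈-filter⁺; ∈-cartesianProductWith⁺; ∈-resp-≈)
import Data.List.Membership.Setoid as Membership
open import Data.List.Properties using (map-++; map-cong; map-tabulate; filter-accept; filter-reject; filter-some; filter-none)
import Data.List.Relation.Unary.All as All
import Data.List.Relation.Unary.All.Properties as All
open import Data.List.Relation.Unary.AllPairs using ([]; _∷_)
open import Data.List.Relation.Unary.Any as Any using (here)
import Data.List.Relation.Unary.Any.Properties as Any
import Data.List.Relation.Unary.Unique.Propositional.Properties as Uniqueₚ
import Data.List.Relation.Unary.Unique.Setoid as Uniqueness
import Data.List.Relation.Unary.Unique.Setoid.Properties as Unique
open import Data.Nat.Base using (ℕ; zero; suc; _+_; _≤_; _<_; _*_; _/_; z≤n; s≤s; NonZero; ≢-nonZero; ≢-nonZero⁻¹)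
open import Data.Nat.Divisibility using (_∣_; ∣-trans; ∣⇒≤)
open import Data.Nat.DivMod using (*-/-assoc; m≥n⇒m/n>0)
open import Data.Nat.GCD using (gcd)
open import Data.Nat.LCM using (lcm; m∣lcm[m,n]; n∣lcm[m,n]; gcd*lcm)
open import Data.Nat.ListAction using () renaming (sum to listSum)
open import Data.Nat.ListAction.Properties using (sum-++)
open import Data.Nat.Properties hiding (_≟_)
open import Algebra.Properties.CommutativeSemigroup +-commutativeSemigroup using (interchange)
open import Data.Product.Base using (_×_; ∃-syntax; _,_)
open import Function.Base using (id; _∘_)
open import Function.Bundles using (Inverse; _⇔_; mk⇔; Equivalence)
open import Level using (Level)
open import Relation.Binary.PropositionalEquality using (_≡_; _≢_; refl; sym; trans; cong; cong₂; subst; setoid; module ≡-Reasoning)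
open import Relation.Nullary.Decidable using (yes; no; does; ¬?)
open import Relation.Nullary.Negation using (¬_; contradiction)
open import Relation.Unary using (Pred; Decidable)

private
  variable
    a b c p : Level
    A : Set a
    B : Set b
    C : Set c

-- Finite sums indexed by lists.

∑ : List A → (A → ℕ) → ℕ
∑ xs f = listSum (map f xs)

syntax ∑ xs (λ x → e) = ∑[ x ∈ xs ] e
infixr 6.5 ∑

∑-cong : ∀ (xs : List A) {f g : A → ℕ} → (∀ x → f x ≡ g x) → ∑ xs f ≡ ∑ xs g
∑-cong xs f≗g = cong listSum (map-cong f≗g xs)

∑-mono-≤ : ∀ (xs : List A) {f g : A → ℕ} → (∀ x → f x ≤ g x) → ∑ xs f ≤ ∑ xs g
∑-mono-≤ []       f≤g = z≤n
∑-mono-≤ (x ∷ xs) f≤g = +-mono-≤ (f≤g x) (∑-mono-≤ xs f≤g)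

∑-++ : ∀ (xs ys : List A) (f : A → ℕ) → ∑ (xs ++ ys) f ≡ ∑ xs f + ∑ ys f
∑-++ xs ys f = trans (cong listSum (map-++ f xs ys)) (sum-++ (map f xs) (map f ys))

∑-map : ∀ (h : A → B) (xs : List A) (f : B → ℕ) → ∑ (map h xs) f ≡ ∑ xs (f ∘ h)
∑-map h []       f = refl
∑-map h (x ∷ xs) f = cong (f (h x) +_) (∑-map h xs f)

∑-concatMap : ∀ (h : A → List B) (xs : List A) (f : B → ℕ) →
              ∑ (concatMap h xs) f ≡ ∑[ x ∈ xs ] ∑ (h x) f
∑-concatMap h []       f = refl
∑-concatMap h (x ∷ xs) f =
  trans (∑-++ (h x) (concatMap h xs) f) (cong (∑ (h x) f +_) (∑-concatMap h xs f))

∑-cartesianProductWith : ∀ (h : A → B → C) xs ys (f : C → ℕ) →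
                         ∑ (cartesianProductWith h xs ys) f ≡ ∑[ x ∈ xs ] ∑[ y ∈ ys ] f (h x y)
∑-cartesianProductWith h []       ys f = refl
∑-cartesianProductWith h (x ∷ xs) ys f =
  trans (∑-++ (map (h x) ys) _ f)
        (cong₂ _+_ (∑-map (h x) ys f) (∑-cartesianProductWith h xs ys f))

∑-replicate : ∀ t (x : A) (f : A → ℕ) → ∑ (replicate t x) f ≡ t * f x
∑-replicate zero    x f = refl
∑-replicate (suc t) x f = cong (f x +_) (∑-replicate t x f)

∑-zero : ∀ (xs : List A) → ∑[ x ∈ xs ] 0 ≡ 0
∑-zero []       = refl
∑-zero (x ∷ xs) = ∑-zero xs

∑-distrib-+ : ∀ (xs : List A) (f g : A → ℕ) → ∑[ x ∈ xs ] (f x + g x) ≡ ∑ xs f + ∑ xs g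
∑-distrib-+ []       f g = refl
∑-distrib-+ (x ∷ xs) f g =
  trans (cong (f x + g x +_) (∑-distrib-+ xs f g)) (interchange (f x) (g x) _ _)

∑-*ˡ : ∀ t (xs : List A) (f : A → ℕ) → ∑[ x ∈ xs ] (t * f x) ≡ t * ∑ xs f
∑-*ˡ t []       f = sym (*-zeroʳ t)
∑-*ˡ t (x ∷ xs) f = trans (cong (t * f x +_) (∑-*ˡ t xs f)) (sym (*-distribˡ-+ t (f x) _))

∑-*ʳ : ∀ t (xs : List A) (f : A → ℕ) → ∑[ x ∈ xs ] (f x * t) ≡ ∑ xs f * t
∑-*ʳ t xs f = trans (∑-cong xs λ x → *-comm (f x) t) (trans (∑-*ˡ t xs f) (*-comm t _))

∑-comm : ∀ (xs : List A) (ys : List B) (f : A → B → ℕ) →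
         ∑[ x ∈ xs ] ∑[ y ∈ ys ] f x y ≡ ∑[ y ∈ ys ] ∑[ x ∈ xs ] f x y
∑-comm []       ys f = sym (∑-zero ys)
∑-comm (x ∷ xs) ys f =
  trans (cong (∑ ys (f x) +_) (∑-comm xs ys f)) (sym (∑-distrib-+ ys (f x) _))

-- Moving the condition into the summand makes the index list independent of any outer index, so
-- that `∑-comm` becomes applicable.
∑-filter : ∀ {P : Pred A p} (P? : Decidable P) xs (f : A → ℕ) →
           ∑ (filter P? xs) f ≡ ∑[ x ∈ xs ] (if does (P? x) then f x else 0)
∑-filter P? []       f = refl
∑-filter P? (x ∷ xs) f with does (P? x)
... | true  = cong (f x +_) (∑-filter P? xs f)
... | false = ∑-filter P? xs f

∑-allFin : ∀ m (f : Fin m → ℕ) → ∑ (allFin m) f ≡ sum f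
∑-allFin m f = trans (cong listSum (map-tabulate id f)) (sum-tabulate m f)
  where
  sum-tabulate : ∀ m (f : Fin m → ℕ) → listSum (tabulate f) ≡ sum f
  sum-tabulate zero    f = refl
  sum-tabulate (suc m) f = cong (f zero +_) (sum-tabulate m (f ∘ suc))

-- Least common multiples of a family of positive integers.

lcm≢0 : ∀ m n .{{_ : NonZero m}} .{{_ : NonZero n}} → NonZero (lcm m n)
lcm≢0 m n = ≢-nonZero λ lcm≡0 → ≢-nonZero⁻¹ (m * n) {{m*n≢0 m n}} (begin
  m * n               ≡⟨ gcd*lcm m n ⟨
  gcd m n * lcm m n   ≡⟨ cong (gcd m n *_) lcm≡0 ⟩
  gcd m n * 0         ≡⟨ *-zeroʳ (gcd m n) ⟩
  0                   ∎)
  where open ≡-Reasoning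

lcms≢0 : ∀ {m} (k : Fin m → ℕ) → (∀ i → NonZero (k i)) → NonZero (lcms k)
-- The empty lcm is 1.
lcms≢0 {zero}  k k≢0 = _
lcms≢0 {suc m} k k≢0 = lcm≢0 (k zero) _ {{k≢0 zero}} {{lcms≢0 (k ∘ suc) (k≢0 ∘ suc)}}

∣lcms : ∀ {m} (k : Fin m → ℕ) i → k i ∣ lcms k
∣lcms k zero    = m∣lcm[m,n] (k zero) _
∣lcms k (suc i) = ∣-trans (∣lcms (k ∘ suc) i) (n∣lcm[m,n] (k zero) _)

-- Multiplicities in multi-sets of group elements.

module _ {c ℓ} (G : AbelianGroup c ℓ) {n : ℕ} (order : HasOrder G n) where

  open AbelianGroup G using (Carrier; _≈_; _⁻¹; _-_; ∙-cong; ⁻¹-cong)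
    renaming (ε to 0#; setoid to S; refl to ≈-refl; sym to ≈-sym; trans to ≈-trans)
  open AbelianGroupProperties G using (⁻¹-anti-homo‿-; ⁻¹-involutive; ε⁻¹≈ε)
  open Membership S using (_∈_)
  open Uniqueness S using (Unique)
  open Inverse order using (to; from; from-cong; inverseˡ; strictlyInverseʳ)

  private
    mult = multiplicity G order
    _≟_  = _≈?_ G order
    G*   = G∖0 G order

    infixr 7 _⊡_
    _⊡_ = _⊠_ G order
    Δ = D G order

  -- `mult g (x ∷ [])` is the indicator of `g ≈ x`. Counting thus becomes summing, and unions,
  -- repetitions and differences are handled by the rules for `∑`.
  mult-∑ : ∀ g xs → mult g xs ≡ ∑[ x ∈ xs ] mult g (x ∷ [])
  mult-∑ g []       = refl
  mult-∑ g (x ∷ xs) with does (g ≟ x)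
  ... | true  = cong suc (mult-∑ g xs)
  ... | false = mult-∑ g xs

  mult-[]-≈ : ∀ {g x} → g ≈ x → mult g (x ∷ []) ≡ 1
  mult-[]-≈ {g} g≈x = cong length (filter-accept (g ≟_) g≈x)

  mult-[]-≉ : ∀ {g x} → ¬ g ≈ x → mult g (x ∷ []) ≡ 0
  mult-[]-≉ {g} g≉x = cong length (filter-reject (g ≟_) g≉x)

  -- Lets an equation be rewritten inside an indicator, which is how group identities enter the
  -- counts.
  mult-[] : ∀ {g h x y} → g ≈ x ⇔ h ≈ y → mult g (x ∷ []) ≡ mult h (y ∷ [])
  mult-[] {g} {h} {x} {y} eqv with g ≟ x | h ≟ y
  ... | yes g≈x | yes h≈y = trans (mult-[]-≈ g≈x) (sym (mult-[]-≈ h≈y))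
  ... | no  g≉x | no  h≉y = trans (mult-[]-≉ g≉x) (sym (mult-[]-≉ h≉y))
  ... | yes g≈x | no  h≉y = contradiction (Equivalence.to eqv g≈x) h≉y
  ... | no  g≉x | yes h≈y = contradiction (Equivalence.from eqv h≈y) g≉x

  mult-cong : ∀ {g h} xs → g ≈ h → mult g xs ≡ mult h xs
  mult-cong {g} {h} xs g≈h = begin
    mult g xs                     ≡⟨ mult-∑ g xs ⟩
    ∑[ x ∈ xs ] mult g (x ∷ [])   ≡⟨ ∑-cong xs (λ x → mult-[] (mk⇔ (≈-trans (≈-sym g≈h)) (≈-trans g≈h))) ⟩
    ∑[ x ∈ xs ] mult h (x ∷ [])   ≡⟨ mult-∑ h xs ⟨
    mult h xs                     ∎
    where open ≡-Reasoning

  mult-concatMap : ∀ {A : Set a} g (h : A → List Carrier) xs →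
                   mult g (concatMap h xs) ≡ ∑[ x ∈ xs ] mult g (h x)
  mult-concatMap g h xs = begin
    mult g (concatMap h xs)                      ≡⟨ mult-∑ g (concatMap h xs) ⟩
    ∑[ y ∈ concatMap h xs ] mult g (y ∷ [])      ≡⟨ ∑-concatMap h xs _ ⟩
    ∑[ x ∈ xs ] ∑[ y ∈ h x ] mult g (y ∷ [])     ≡⟨ ∑-cong xs (λ x → mult-∑ g (h x)) ⟨
    ∑[ x ∈ xs ] mult g (h x)                     ∎
    where open ≡-Reasoning

  -- The function `f` is arbitrary because in `mult-D-⊠` it is itself a sum over a second block, not
  -- only an indicator.
  ∑-⊠ : ∀ t xs (f : Carrier → ℕ) → ∑ (t ⊡ xs) f ≡ t * ∑ xs f
  ∑-⊠ t xs f = begin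
    ∑ (t ⊡ xs) f                          ≡⟨ ∑-concatMap (replicate t) xs f ⟩
    ∑[ x ∈ xs ] ∑ (replicate t x) f       ≡⟨ ∑-cong xs (λ x → ∑-replicate t x f) ⟩
    ∑[ x ∈ xs ] (t * f x)                 ≡⟨ ∑-*ˡ t xs f ⟩
    t * ∑ xs f                            ∎
    where open ≡-Reasoning

  mult-⊠ : ∀ g t xs → mult g (t ⊡ xs) ≡ t * mult g xs
  mult-⊠ g t xs = begin
    mult g (t ⊡ xs)                          ≡⟨ mult-∑ g (t ⊡ xs) ⟩
    ∑[ x ∈ t ⊡ xs ] mult g (x ∷ [])          ≡⟨ ∑-⊠ t xs _ ⟩
    t * (∑[ x ∈ xs ] mult g (x ∷ []))        ≡⟨ cong (t *_) (mult-∑ g xs) ⟨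
    t * mult g xs                            ∎
    where open ≡-Reasoning

  -- Counting differences.

  mult-D : ∀ g xs ys → mult g (Δ xs ys) ≡ ∑[ x ∈ xs ] ∑[ y ∈ ys ] mult g (x - y ∷ [])
  mult-D g xs ys = trans (mult-∑ g (Δ xs ys)) (∑-cartesianProductWith _-_ xs ys _)

  ⁻¹-transpose : ∀ {g} x y → g ≈ x - y → g ⁻¹ ≈ y - x
  ⁻¹-transpose x y g≈x-y = ≈-trans (⁻¹-cong g≈x-y) (⁻¹-anti-homo‿- x y)

  mult-D-flip : ∀ g xs ys → mult g (Δ xs ys) ≡ mult (g ⁻¹) (Δ ys xs)
  mult-D-flip g xs ys = begin
    mult g (Δ xs ys)                                        ≡⟨ mult-D g xs ys ⟩
    ∑[ x ∈ xs ] ∑[ y ∈ ys ] mult g (x - y ∷ [])             ≡⟨ ∑-cong xs (λ x → ∑-cong ys λ y → mult-[] (flip x y)) ⟩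
    ∑[ x ∈ xs ] ∑[ y ∈ ys ] mult (g ⁻¹) (y - x ∷ [])        ≡⟨ ∑-comm xs ys _ ⟩
    ∑[ y ∈ ys ] ∑[ x ∈ xs ] mult (g ⁻¹) (y - x ∷ [])        ≡⟨ mult-D (g ⁻¹) ys xs ⟨
    mult (g ⁻¹) (Δ ys xs)                                   ∎
    where
    open ≡-Reasoning
    flip : ∀ x y → g ≈ x - y ⇔ g ⁻¹ ≈ y - x
    flip x y = mk⇔ (⁻¹-transpose x y)
                   -- The converse negates once more and cancels the double inverse.
                   (≈-trans (≈-sym (⁻¹-involutive g)) ∘ ⁻¹-transpose y x)

  -- Flipping puts the repeated list outside, where `∑-⊠` extracts the factor `t`. The flipped form
  -- is kept: with `ys` first it is a part of the external differences of the block `ys`.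
  mult-D-⊠ : ∀ g t xs ys → mult g (Δ xs (t ⊡ ys)) ≡ t * mult (g ⁻¹) (Δ ys xs)
  mult-D-⊠ g t xs ys = begin
    mult g (Δ xs (t ⊡ ys))                                     ≡⟨ mult-D-flip g xs (t ⊡ ys) ⟩
    mult (g ⁻¹) (Δ (t ⊡ ys) xs)                                ≡⟨ mult-D (g ⁻¹) (t ⊡ ys) xs ⟩
    ∑[ y ∈ t ⊡ ys ] ∑[ x ∈ xs ] mult (g ⁻¹) (y - x ∷ [])       ≡⟨ ∑-⊠ t ys _ ⟩
    t * (∑[ y ∈ ys ] ∑[ x ∈ xs ] mult (g ⁻¹) (y - x ∷ []))     ≡⟨ cong (t *_) (mult-D (g ⁻¹) ys xs) ⟨
    t * mult (g ⁻¹) (Δ ys xs)                                  ∎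
    where open ≡-Reasoning

  -- Multiplicities among the nonzero elements of the group.

  mult>0 : ∀ {g xs} → g ∈ xs → 0 < mult g xs
  mult>0 = filter-some (_ ≟_)

  Unique⇒mult≤1 : ∀ g {xs} → Unique xs → mult g xs ≤ 1
  Unique⇒mult≤1 g []            = z≤n
  Unique⇒mult≤1 g {x ∷ xs} (x∉xs ∷ xs!) with g ≟ x
  ... | no  g≉x = ≤-trans (≤-reflexive (cong length (filter-reject (g ≟_) g≉x))) (Unique⇒mult≤1 g xs!)
  ... | yes g≈x = ≤-reflexive (begin
    mult g (x ∷ xs)    ≡⟨ cong length (filter-accept (g ≟_) g≈x) ⟩
    suc (mult g xs)    ≡⟨ cong (suc ∘ length) (filter-none (g ≟_) (All.map (λ x≉y g≈y → x≉y (≈-trans (≈-sym g≈x) g≈y)) x∉xs)) ⟩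
    1                  ∎)
    where open ≡-Reasoning

  -- The enumeration `from` has the left inverse `to`, so it is injective and lists no group element
  -- twice; filtering preserves this.
  mult-G∖0≤1 : ∀ g → mult g G* ≤ 1
  mult-G∖0≤1 g = Unique⇒mult≤1 g
    (Unique.filter⁺ S _ (Unique.map⁺ (setoid _) S from-injective (Uniqueₚ.allFin⁺ n)))
    where
    from-injective : ∀ {i j} → from i ≈ from j → i ≡ j
    from-injective {i} {j} eq = trans (sym (inverseˡ ≈-refl)) (inverseˡ eq)

  ∈-G∖0 : ∀ {g} → ¬ g ≈ 0# → g ∈ G*
  ∈-G∖0 {g} g≉0 = ∈-filter⁺ S (λ x → ¬? (x ≟ 0#)) (λ x≈y x≉0 → x≉0 ∘ ≈-trans x≈y)
    (∈-resp-≈ S (strictlyInverseʳ g) (∈-map⁺ (setoid _) S from-cong (∈ₚ-allFin (to g)))) g≉0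

  mult-0-G∖0 : ∀ {g} → g ≈ 0# → mult g G* ≡ 0
  mult-0-G∖0 {g} g≈0 = cong length (filter-none (g ≟_)
    (All.map (λ x≉0 g≈x → x≉0 (≈-trans (≈-sym g≈x) g≈0))
             (All.all-filter (λ x → ¬? (x ≟ 0#)) (map from (allFin n)))))

  -- Carries a bound at the inverse of `g` back to `g`. If `g` is the identity, so is its inverse
  -- and the left side is 0; otherwise the left side is at most 1 and the right side at least 1.
  mult-⁻¹-G∖0 : ∀ g → mult (g ⁻¹) G* ≤ mult g G*
  mult-⁻¹-G∖0 g with g ≟ 0#
  ... | yes g≈0 = ≤-trans (≤-reflexive (mult-0-G∖0 (≈-trans (⁻¹-cong g≈0) ε⁻¹≈ε))) z≤n
  ... | no  g≉0 = ≤-trans (mult-G∖0≤1 (g ⁻¹)) (mult>0 (∈-G∖0 g≉0))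

  ≢[]⇒∈ : ∀ {xs} → xs ≢ [] → ∃[ x ] x ∈ xs
  ≢[]⇒∈ {[]}    xs≢[] = contradiction refl xs≢[]
  ≢[]⇒∈ {x ∷ _} _     = x , here ≈-refl

  -- Both sides range over the ordered pairs of distinct indices, a symmetric condition.
  ∑-others-comm : ∀ m (f : Fin m → Fin m → ℕ) →
                  ∑[ i ∈ allFin m ] ∑[ j ∈ others G order i ] f i j ≡
                  ∑[ j ∈ allFin m ] ∑[ i ∈ others G order j ] f i j
  ∑-others-comm m f = begin
    ∑[ i ∈ xs ] ∑[ j ∈ others G order i ] f i j
      ≡⟨ ∑-cong xs (λ i → ∑-filter (λ j → ¬? (j Fin.≟ i)) xs (f i)) ⟩
    ∑[ i ∈ xs ] ∑[ j ∈ xs ] (if does (¬? (j Fin.≟ i)) then f i j else 0)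
      ≡⟨ ∑-comm xs xs _ ⟩
    ∑[ j ∈ xs ] ∑[ i ∈ xs ] (if does (¬? (j Fin.≟ i)) then f i j else 0)
      -- After the exchange the test still reads `j ≢ i`, whereas `others` at `j` tests `i ≢ j`.
      ≡⟨ ∑-cong xs (λ j → ∑-cong xs λ i → cong (if_then f i j else 0) (does-≟-sym j i)) ⟩
    ∑[ j ∈ xs ] ∑[ i ∈ xs ] (if does (¬? (i Fin.≟ j)) then f i j else 0)
      ≡⟨ ∑-cong xs (λ j → ∑-filter (λ i → ¬? (i Fin.≟ j)) xs (λ i → f i j)) ⟨
    ∑[ j ∈ xs ] ∑[ i ∈ others G order j ] f i j
      ∎
    where
    open ≡-Reasoning
    xs = allFin m
    does-≟-sym : ∀ (i j : Fin m) → does (¬? (i Fin.≟ j)) ≡ does (¬? (j Fin.≟ i))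
    does-≟-sym i j with i Fin.≟ j | j Fin.≟ i
    ... | yes _   | yes _   = refl
    ... | no  _   | no  _   = refl
    ... | yes i≡j | no  j≢i = contradiction (sym i≡j) j≢i
    ... | no  i≢j | yes j≡i = contradiction (sym j≡i) i≢j

  -- A bound on the multiplicities alone does not give the inclusion, since `G*` omits the identity.
  -- The known inclusion for `N` shows that `W` omits it too.
  least-bound : ∀ W N → 0 < N → _⊆_ G order W (N ⊡ G*) →
                ∃[ μ ] (0 < μ × _⊆_ G order W (μ ⊡ G*) ×
                        (∀ ν → 0 < ν → _⊆_ G order W (ν ⊡ G*) → μ ≤ ν))
  least-bound W N 0<N W⊆N = μ , ⊥≤max 1 mults , bounded , smallest
    where
    mults = map (λ i → mult (from i) W) (allFin n)
    -- The default 1 makes `μ` positive even if all multiplicities vanish.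
    μ     = max 1 mults

    mult≤μ : ∀ g → mult g W ≤ μ
    mult≤μ g = ≤-trans
      -- The maximum runs over the elements `from i` only; any `g` is equivalent to `from (to g)`.
      (≤-reflexive (mult-cong W (≈-sym (strictlyInverseʳ g))))
      (All.lookup (All.map⁻ (xs≤max 1 mults)) (∈ₚ-allFin (to g)))

    -- Here `y` stands for the multiplicity in `G*`. Where it is 0, the bound by `N` already forces
    -- `x` to be 0; where it is positive, `μ` itself suffices.
    ≤*⇒≤* : ∀ {x} y → x ≤ N * y → x ≤ μ → x ≤ μ * y
    ≤*⇒≤* zero    x≤N*0 _   = ≤-trans x≤N*0 (≤-reflexive (trans (*-zeroʳ N) (sym (*-zeroʳ μ))))
    ≤*⇒≤* (suc y) _     x≤μ = ≤-trans x≤μ (m≤m*n μ (suc y))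

    bounded : ∀ g → mult g W ≤ mult g (μ ⊡ G*)
    bounded g = ≤-trans
      (≤*⇒≤* (mult g G*) (≤-trans (W⊆N g) (≤-reflexive (mult-⊠ g N G*))) (mult≤μ g))
      (≤-reflexive (sym (mult-⊠ g μ G*)))

    smallest : ∀ ν → 0 < ν → _⊆_ G order W (ν ⊡ G*) → μ ≤ ν
    -- Positivity of `ν` covers the default 1 of the maximum, and `mult≤ν` covers its other entries.
    smallest ν 0<ν W⊆ν = max≤v⁺ 0<ν (All.map⁺ (All.universal (λ i → mult≤ν (from i)) (allFin n)))
      where
      open ≤-Reasoning
      mult≤ν : ∀ g → mult g W ≤ ν
      mult≤ν g = begin
        mult g W          ≤⟨ W⊆ν g ⟩
        mult g (ν ⊡ G*)   ≡⟨ mult-⊠ g ν G* ⟩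
        ν * mult g G*     ≤⟨ *-monoʳ-≤ ν (mult-G∖0≤1 g) ⟩
        ν * 1             ≡⟨ *-identityʳ ν ⟩
        ν                 ∎

  -- The external differences of a family and their bounds.

  module _ {m : ℕ} {k : Fin m → ℕ} (𝓑 : DisjointFamily G order m k) where

    open DisjointFamily 𝓑

    private
      weight : Fin m → ℕ
      weight i = (lcms k / k i) {{k-nonZero i}}

      ext : Fin m → List Carrier
      ext = externalDifferences G order 𝓑

    -- The double union is regrouped by the index of its weighted block, so that each weight
    -- multiplies the unweighted external differences of one block.
    mult-weightedExternalDifferences : ∀ g →
      mult g (weightedExternalDifferences G order 𝓑) ≡
      ∑[ j ∈ allFin m ] (weight j * mult (g ⁻¹) (ext j))
    mult-weightedExternalDifferences g = begin
      mult g (weightedExternalDifferences G order 𝓑)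
        ≡⟨ mult-concatMap g _ (allFin m) ⟩
      ∑[ i ∈ allFin m ] mult g (concatMap (λ j → Δ (block i) (weightedBlock j)) (others G order i))
        ≡⟨ ∑-cong (allFin m) (λ i → mult-concatMap g _ (others G order i)) ⟩
      ∑[ i ∈ allFin m ] ∑[ j ∈ others G order i ] mult g (Δ (block i) (weightedBlock j))
        ≡⟨ ∑-cong (allFin m) (λ i → ∑-cong (others G order i) λ j → mult-D-⊠ g (weight j) (block i) (block j)) ⟩
      ∑[ i ∈ allFin m ] ∑[ j ∈ others G order i ] (weight j * mult (g ⁻¹) (Δ (block j) (block i)))
        -- The weight depends on `j` alone, so with `j` outermost it leaves the inner sum.
        ≡⟨ ∑-others-comm m _ ⟩
      ∑[ j ∈ allFin m ] ∑[ i ∈ others G order j ] (weight j * mult (g ⁻¹) (Δ (block j) (block i)))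
        ≡⟨ ∑-cong (allFin m) (λ j → ∑-*ˡ (weight j) (others G order j) _) ⟩
      ∑[ j ∈ allFin m ] (weight j * (∑[ i ∈ others G order j ] mult (g ⁻¹) (Δ (block j) (block i))))
        ≡⟨ ∑-cong (allFin m) (λ j → cong (weight j *_) (mult-concatMap (g ⁻¹) _ (others G order j))) ⟨
      ∑[ j ∈ allFin m ] (weight j * mult (g ⁻¹) (ext j))
        ∎
      where open ≡-Reasoning

    module _ (Λ : Fin m → ℕ) (bgsedf : IsBGSEDF G order 𝓑 Λ) where

      private
        term : Fin m → ℕ
        term i = (Λ i * lcms k / k i) {{k-nonZero i}}

      -- `term i` divides after multiplying and `weight i` before; the two agree because `k i`
      -- divides `lcms k`.
      Λ*weight : ∀ i → term i ≡ Λ i * weight i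
      Λ*weight i = *-/-assoc (Λ i) {{k-nonZero i}} (∣lcms k i)

      weightedExternalDifferences⊆ :
        _⊆_ G order (weightedExternalDifferences G order 𝓑) (sum term ⊡ G*)
      weightedExternalDifferences⊆ g = begin
        mult g (weightedExternalDifferences G order 𝓑)
          ≡⟨ mult-weightedExternalDifferences g ⟩
        ∑[ j ∈ allFin m ] (weight j * mult (g ⁻¹) (ext j))
          ≤⟨ ∑-mono-≤ (allFin m) summand≤ ⟩
        ∑[ j ∈ allFin m ] (term j * mult g G*)
          ≡⟨ ∑-*ʳ (mult g G*) (allFin m) term ⟩
        ∑ (allFin m) term * mult g G*
          ≡⟨ cong (_* mult g G*) (∑-allFin m term) ⟩
        sum term * mult g G*
          ≡⟨ mult-⊠ g (sum term) G* ⟨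
        mult g (sum term ⊡ G*)
          ∎
        where
        open ≤-Reasoning
        summand≤ : ∀ j → weight j * mult (g ⁻¹) (ext j) ≤ term j * mult g G*
        summand≤ j = begin
          -- The hypothesis on block `j` is applied at the inverse of `g`.
          weight j * mult (g ⁻¹) (ext j)        ≤⟨ *-monoʳ-≤ (weight j) (bgsedf j (g ⁻¹)) ⟩
          weight j * mult (g ⁻¹) (Λ j ⊡ G*)     ≡⟨ cong (weight j *_) (mult-⊠ (g ⁻¹) (Λ j) G*) ⟩
          weight j * (Λ j * mult (g ⁻¹) G*)     ≤⟨ *-monoʳ-≤ (weight j) (*-monoʳ-≤ (Λ j) (mult-⁻¹-G∖0 g)) ⟩
          weight j * (Λ j * mult g G*)          ≡⟨ *-assoc (weight j) (Λ j) _ ⟨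
          weight j * Λ j * mult g G*            ≡⟨ cong (_* mult g G*) (trans (*-comm (weight j) (Λ j)) (sym (Λ*weight j))) ⟩
          term j * mult g G*                    ∎

      -- A second block, nonempty like the first, supplies a difference. This is what excludes
      -- `Λ i ≡ 0` below.
      externalDifference : ∀ i j → j ≢ i → ∃[ g ] g ∈ ext i
      externalDifference i j j≢i =
        let x , x∈Bᵢ = ≢[]⇒∈ (nonempty i)
            y , y∈Bⱼ = ≢[]⇒∈ (nonempty j)
            j∈others = ∈ₚ-filter⁺ (λ l → ¬? (l Fin.≟ i)) (∈ₚ-allFin j) j≢i
        in x - y , Any.concatMap⁺ _ (Any.map
             (λ { refl → ∈-cartesianProductWith⁺ S S S (λ x≈x′ y≈y′ → ∙-cong x≈x′ (⁻¹-cong y≈y′)) x∈Bᵢ y∈Bⱼ })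
             j∈others)

      -- Both factors are positive: `Λ i` because it bounds a nonempty multi-set, the weight because
      -- `k i` divides the nonzero `lcms k` and so does not exceed it.
      term>0 : ∀ i j → j ≢ i → 0 < term i
      term>0 i j j≢i = subst (0 <_) (sym (Λ*weight i))
        (*-mono-≤ Λ>0 (m≥n⇒m/n>0 {{k-nonZero i}} (∣⇒≤ {{lcms≢0 k k-nonZero}} (∣lcms k i))))
        where
        Λ>0 : 0 < Λ i
        Λ>0 with g , g∈ext ← externalDifference i j j≢i =
          -- With `Λ i ≡ 0` the difference `g` would have multiplicity 0, although it occurs.
          n≢0⇒n>0 λ Λ≡0 → contradiction
            (≤-trans (mult>0 g∈ext) (≤-trans (bgsedf i g) (≤-reflexive
              (trans (mult-⊠ g (Λ i) G*) (cong (_* mult g G*) Λ≡0)))))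
            λ ()

lemma8 : ∀ {c ℓ} (G : AbelianGroup c ℓ) (n : ℕ) (order : HasOrder G n)
    (m : ℕ) → 2 ≤ m →
    (k : Fin m → ℕ) (𝓑 : DisjointFamily G order m k) (Λ : Fin m → ℕ) →
    IsBGSEDF G order 𝓑 Λ →
    ∃[ μ ] (IsBSWEDF G order 𝓑 (sum k) μ ×
    μ ≤ sum (λ i → (Λ i * lcms k / k i) {{DisjointFamily.k-nonZero 𝓑 i}}))
lemma8 G n order (suc (suc m)) (s≤s (s≤s z≤n)) k 𝓑 Λ bgsedf =
  -- Since `m` is at least 2, the indices `zero` and `suc zero` are distinct; the summand at `zero`
  -- alone makes the whole sum positive.
  let 0<N = ≤-trans (term>0 G order 𝓑 Λ bgsedf zero (suc zero) λ ()) (m≤m+n _ _)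
      W⊆N = weightedExternalDifferences⊆ G order 𝓑 Λ bgsedf
      μ , 0<μ , W⊆μ , smallest = least-bound G order (weightedExternalDifferences G order 𝓑) _ 0<N W⊆N
  in μ
   , record { total = refl ; positive = 0<μ ; bounded = W⊆μ ; smallest = smallest }
   -- The sum is itself an admissible positive bound, so minimality of `μ` gives the inequality.
   , smallest _ 0<N W⊆N
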